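{- Let $n\geq 2$ be an integer, let $c,\varepsilon\in[0,1]$, and let $G$ be a connected graph on $n$ vertices. Assume that $G$ contains no empty bipartite graph with sides of size at least $c\cdot n$, i.e. there are no two disjoint vertex sets $X,Y\subseteq V(G)$ with $|X|,|Y|\geq c\cdot n$ such that no edge of $G$ joins a vertex of $X$ to a vertex of $Y$. Assume moreover that every vertex $x$ of $G$ has closed degree $\overline{d(x)}\leq \varepsilon\cdot n$. Then for every vertex $x$ of $G$ there is an induced path on $k$ vertices in $G$ having $x$ as an endpoint, with $k\geq \frac{1}{2(\varepsilon+c)}$.
   Context: All graphs are finite and simple. The closed degree of a vertex $x$ is $\overline{d(x)}=d(x)+1=|N[x]|$, where $N[x]=\{x\}\cup\{y: xy\in E(G)\}$ is the closed neighborhood. An induced path on $k$ vertices ($P_k$) is a set of $k$ vertices $v_1,\dots,v_k$ such that $v_iv_j$ is an edge if and only if $|i-j|=1$; "starting in $x$" means $v_1=x$. -}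

module Defs where

open import Data.Fin.Base using (Fin; toℕ)
open import Data.Fin.Subset using (Subset; _∈_; _∩_; _∪_; ⁅_⁆; ∣_∣; Empty)
open import Data.Integer.Base using (+_)
open import Data.Nat.Base using (ℕ; zero; suc; ∣_-_∣)
open import Data.Product using (_×_; _,_; ∃-syntax; Σ-syntax)
open import Data.Rational.Base as ℚ using (ℚ; 0ℚ; 1ℚ; ½; positive; 1/_)
import Data.Rational.Properties as ℚ
open import Data.Rational.Solver using (module +-*-Solver)
open import Data.Sum.Base using ([_,_]′)
open import Data.Vec.Base using (tabulate)
open import Function.Bundles using (_⇔_)
open import Function.Definitions using (Injective)
open import Level using (0ℓ)
open import Relation.Binary.Core using (Rel)
open import Relation.Binary.Construct.Closure.ReflexiveTransitive using (Star)
open import Relation.Binary.Definitions using (Decidable; Irreflexive; Symmetric)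
open import Relation.Binary.PropositionalEquality using (_≡_; refl; sym; trans; cong; subst; subst₂)
open import Relation.Nullary using (¬_; does)

-- Two-sided Dedekind cuts.  L q means q < x, U q means x < q.
-- 'located' is the metric form of locatedness; it also gives the
-- inhabitedness of both sides (take δ = 1).
record ℝ : Set₁ where
  field
    L U     : ℚ → Set
    L-lower : ∀ {p q} → p ℚ.< q → L q → L p
    U-upper : ∀ {p q} → p ℚ.< q → U p → U q
    L-open  : ∀ {p} → L p → ∃[ q ] p ℚ.< q × L q
    U-open  : ∀ {q} → U q → ∃[ p ] p ℚ.< q × U p
    L<U     : ∀ {p q} → L p → U q → p ℚ.< q
    located : ∀ δ → 0ℚ ℚ.< δ → ∃[ p ] ∃[ q ] L p × U q × q ℚ.< p ℚ.+ δ

open ℝ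

infix 4 _≤_ _<_

_≤_ : ℝ → ℝ → Set
x ≤ y = ∀ q → L x q → L y q

_<_ : ℝ → ℝ → Set
x < y = ∃[ q ] U x q × L y q

private
  p+δ-δ≡p : ∀ p δ → (p ℚ.+ δ) ℚ.- δ ≡ p
  p+δ-δ≡p p δ = trans (ℚ.+-assoc p δ (ℚ.- δ)) (trans (cong (p ℚ.+_) (ℚ.+-inverseʳ δ)) (ℚ.+-identityʳ p))

  q-δ+δ≡q : ∀ q δ → (q ℚ.- δ) ℚ.+ δ ≡ q
  q-δ+δ≡q q δ = trans (ℚ.+-assoc q (ℚ.- δ) δ) (trans (cong (q ℚ.+_) (ℚ.+-inverseˡ δ)) (ℚ.+-identityʳ q))

  q<p+δ⇒q-δ<p : ∀ {p q} δ → q ℚ.< p ℚ.+ δ → q ℚ.- δ ℚ.< p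
  q<p+δ⇒q-δ<p {p} {q} δ h = subst (q ℚ.- δ ℚ.<_) (p+δ-δ≡p p δ) (ℚ.+-monoˡ-< (ℚ.- δ) h)

  q-δ<p⇒q<p+δ : ∀ {p q} δ → q ℚ.- δ ℚ.< p → q ℚ.< p ℚ.+ δ
  q-δ<p⇒q<p+δ {p} {q} δ h = subst (ℚ._< p ℚ.+ δ) (q-δ+δ≡q q δ) (ℚ.+-monoˡ-< δ h)

  Widening : (p q δ : ℚ) → Set
  Widening p q δ = ∃[ p′ ] ∃[ q′ ] p′ ℚ.< p × q ℚ.< q′ × q′ ℚ.< p′ ℚ.+ δ

  widen : ∀ {p q δ} → q ℚ.< p ℚ.+ δ → Widening p q δ
  widen {p} {q} {δ} q<p+δ = step₁ (ℚ.<-dense q<p+δ)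
    where
    step₂ : ∀ q′ → q ℚ.< q′ → (∃[ p′ ] q′ ℚ.- δ ℚ.< p′ × p′ ℚ.< p) → Widening p q δ
    step₂ q′ q<q′ (p′ , q′-δ<p′ , p′<p) = p′ , q′ , p′<p , q<q′ , q-δ<p⇒q<p+δ δ q′-δ<p′
    step₁ : (∃[ q′ ] q ℚ.< q′ × q′ ℚ.< p ℚ.+ δ) → Widening p q δ
    step₁ (q′ , q<q′ , q′<p+δ) = step₂ q′ q<q′ (ℚ.<-dense (q<p+δ⇒q-δ<p δ q′<p+δ))

fromℚ : ℚ → ℝ
fromℚ r = record
  { L       = ℚ._< r
  ; U       = r ℚ.<_
  ; L-lower = ℚ.<-trans
  ; U-upper = λ p<q r<p → ℚ.<-trans r<p p<q
  ; L-open  = ℚ.<-dense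
  ; U-open  = λ r<q → let (p , r<p , p<q) = ℚ.<-dense r<q in p , p<q , r<p
  ; L<U     = ℚ.<-trans
  ; located = λ δ 0<δ → widen (subst (ℚ._< r ℚ.+ δ) (ℚ.+-identityʳ r) (ℚ.+-monoʳ-< r 0<δ))
  }

fromℕ : ℕ → ℝ
fromℕ n = fromℚ (+ n ℚ./ 1)

0ℝ 1ℝ : ℝ
0ℝ = fromℕ 0
1ℝ = fromℕ 1

private
  halves : ∀ a b δ → (a ℚ.+ ½ ℚ.* δ) ℚ.+ (b ℚ.+ ½ ℚ.* δ) ≡ (a ℚ.+ b) ℚ.+ δ
  halves = solve 3 (λ a b d → (a :+ con ½ :* d) :+ (b :+ con ½ :* d) := (a :+ b) :+ d) refl
    where open +-*-Solver

  0<½*δ : ∀ {δ} → 0ℚ ℚ.< δ → 0ℚ ℚ.< ½ ℚ.* δ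
  0<½*δ {δ} 0<δ = subst (ℚ._< ½ ℚ.* δ) (ℚ.*-zeroʳ ½) (ℚ.*-monoʳ-<-pos ½ 0<δ)

infixl 6 _+_

_+_ : ℝ → ℝ → ℝ
x + y = record
  { L       = L+
  ; U       = U+
  ; L-lower = λ p<q (a , b , xa , yb , q<ab) → a , b , xa , yb , ℚ.<-trans p<q q<ab
  ; U-upper = λ p<q (a , b , xa , yb , ab<p) → a , b , xa , yb , ℚ.<-trans ab<p p<q
  ; L-open  = λ (a , b , xa , yb , p<ab) →
      let (q , p<q , q<ab) = ℚ.<-dense p<ab in q , p<q , a , b , xa , yb , q<ab
  ; U-open  = λ (a , b , xa , yb , ab<q) →
      let (p , ab<p , p<q) = ℚ.<-dense ab<q in p , p<q , a , b , xa , yb , ab<p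
  ; L<U     = λ (a , b , xa , yb , p<ab) (a′ , b′ , xa′ , yb′ , ab′<q) →
      ℚ.<-trans p<ab (ℚ.<-trans (ℚ.+-mono-< (L<U x xa xa′) (L<U y yb yb′)) ab′<q)
  ; located = λ δ 0<δ → combine δ (located x (½ ℚ.* δ) (0<½*δ 0<δ)) (located y (½ ℚ.* δ) (0<½*δ 0<δ))
  }
  where
  L+ U+ : ℚ → Set
  L+ q = ∃[ a ] ∃[ b ] L x a × L y b × q ℚ.< a ℚ.+ b
  U+ q = ∃[ a ] ∃[ b ] U x a × U y b × a ℚ.+ b ℚ.< q

  combine : ∀ δ →
            (∃[ a ] ∃[ a′ ] L x a × U x a′ × a′ ℚ.< a ℚ.+ ½ ℚ.* δ) →
            (∃[ b ] ∃[ b′ ] L y b × U y b′ × b′ ℚ.< b ℚ.+ ½ ℚ.* δ) →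
            ∃[ p ] ∃[ q ] L+ p × U+ q × q ℚ.< p ℚ.+ δ
  combine δ (a , a′ , xa , xa′ , a′<) (b , b′ , yb , yb′ , b′<) =
    finish (widen (subst (a′ ℚ.+ b′ ℚ.<_) (halves a b δ) (ℚ.+-mono-< a′< b′<)))
    where
    finish : Widening (a ℚ.+ b) (a′ ℚ.+ b′) δ → ∃[ p ] ∃[ q ] L+ p × U+ q × q ℚ.< p ℚ.+ δ
    finish (p , q , p< , <q , q<p+δ) = p , q , (a , b , xa , yb , p<) , (a′ , b′ , xa′ , yb′ , <q) , q<p+δ

infixl 7 _·_

-- n · x is the n-fold sum, used for the products c·n, ε·n and 2(ε+c).
_·_ : ℕ → ℝ → ℝ
zero  · x = 0ℝ
suc n · x = x + n · x

private
  inverse : ∀ {a} → 0ℚ ℚ.< a → ∃[ r ] a ℚ.* r ≡ 1ℚ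
  inverse {a} 0<a = 1/ a , ℚ.*-inverseʳ a
    where instance _ = ℚ.>-nonZero 0<a

  cross : ∀ {a b r s} δ → 0ℚ ℚ.< a → 0ℚ ℚ.< b → a ℚ.* r ≡ 1ℚ → b ℚ.* s ≡ 1ℚ →
          b ℚ.< a ℚ.+ δ ℚ.* (a ℚ.* b) → r ℚ.< s ℚ.+ δ
  cross {a} {b} {r} {s} δ 0<a 0<b ar≡1 bs≡1 h =
    ℚ.*-cancelʳ-<-nonNeg (a ℚ.* b) (subst₂ ℚ._<_ (sym lhs) (sym rhs) h)
    where
    open +-*-Solver
    instance
      _ = positive 0<a
      _ = positive 0<b
      _ = ℚ.pos*pos⇒pos a b
      _ = ℚ.pos⇒nonNeg (a ℚ.* b)
    lhs : r ℚ.* (a ℚ.* b) ≡ b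
    lhs = trans (solve 3 (λ a b r → r :* (a :* b) := (a :* r) :* b) refl a b r)
                (trans (cong (ℚ._* b) ar≡1) (ℚ.*-identityˡ b))
    rhs : (s ℚ.+ δ) ℚ.* (a ℚ.* b) ≡ a ℚ.+ δ ℚ.* (a ℚ.* b)
    rhs = trans (solve 4 (λ a b s d → (s :+ d) :* (a :* b) := (b :* s) :* a :+ d :* (a :* b)) refl a b s δ)
                (cong (ℚ._+ δ ℚ.* (a ℚ.* b)) (trans (cong (ℚ._* a) bs≡1) (ℚ.*-identityˡ a)))

  inverse-anti : ∀ {a b r s} → 0ℚ ℚ.< a → a ℚ.< b → a ℚ.* r ≡ 1ℚ → b ℚ.* s ≡ 1ℚ → s ℚ.< r
  inverse-anti {a} {b} {r} {s} 0<a a<b ar≡1 bs≡1 =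
    subst (s ℚ.<_) (ℚ.+-identityʳ r)
      (cross 0ℚ (ℚ.<-trans 0<a a<b) 0<a bs≡1 ar≡1
        (subst (a ℚ.<_) (sym (trans (cong (b ℚ.+_) (ℚ.*-zeroˡ (b ℚ.* a))) (ℚ.+-identityʳ b))) a<b))

  0<* : ∀ {p q} → 0ℚ ℚ.< p → 0ℚ ℚ.< q → 0ℚ ℚ.< p ℚ.* q
  0<* {p} {q} 0<p 0<q = subst (ℚ._< p ℚ.* q) (ℚ.*-zeroʳ p) (ℚ.*-monoʳ-<-pos p {{positive 0<p}} 0<q)

  δ*-mono : ∀ {a₀ δ a b} → 0ℚ ℚ.< a₀ → 0ℚ ℚ.< δ → a₀ ℚ.≤ a → a₀ ℚ.≤ b →
            δ ℚ.* (a₀ ℚ.* a₀) ℚ.≤ δ ℚ.* (a ℚ.* b)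
  δ*-mono {a₀} {δ} {a} {b} 0<a₀ 0<δ a₀≤a a₀≤b =
    ℚ.*-monoˡ-≤-nonNeg δ {{ℚ.nonNegative (ℚ.<⇒≤ 0<δ)}}
      (ℚ.≤-trans (ℚ.*-monoˡ-≤-nonNeg a₀ {{ℚ.nonNegative (ℚ.<⇒≤ 0<a₀)}} a₀≤b)
                 (ℚ.*-monoʳ-≤-nonNeg b {{ℚ.nonNegative (ℚ.≤-trans (ℚ.<⇒≤ 0<a₀) a₀≤b)}} a₀≤a))

-- q < 1/x iff q < 1/u for some rational u > x;
-- 1/x < q iff 1/l < q for some rational 0 < l < x.
recip : (x : ℝ) → 0ℝ < x → ℝ
recip x (a₀ , 0<a₀ , xa₀) = record
  { L       = L⁻¹
  ; U       = U⁻¹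
  ; L-lower = λ p<q (u , r , xu , e , q<r) → u , r , xu , e , ℚ.<-trans p<q q<r
  ; U-upper = λ p<q (l , r , 0<l , xl , e , r<p) → l , r , 0<l , xl , e , ℚ.<-trans r<p p<q
  ; L-open  = λ (u , r , xu , e , p<r) →
      let (q , p<q , q<r) = ℚ.<-dense p<r in q , p<q , u , r , xu , e , q<r
  ; U-open  = λ (l , r , 0<l , xl , e , r<q) →
      let (p , r<p , p<q) = ℚ.<-dense r<q in p , p<q , l , r , 0<l , xl , e , r<p
  ; L<U     = λ (u , r , xu , e , p<r) (l , r′ , 0<l , xl , e′ , r′<q) →
      ℚ.<-trans p<r (ℚ.<-trans (inverse-anti 0<l (L<U x xl xu) e′ e) r′<q)
  ; located = λ δ 0<δ → invert δ 0<δ (near δ 0<δ (located x (δ ℚ.* (a₀ ℚ.* a₀)) (0<δa₀² δ 0<δ)))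
  }
  where
  L⁻¹ U⁻¹ : ℚ → Set
  L⁻¹ q = ∃[ u ] ∃[ r ] U x u × u ℚ.* r ≡ 1ℚ × q ℚ.< r
  U⁻¹ q = ∃[ l ] ∃[ r ] 0ℚ ℚ.< l × L x l × l ℚ.* r ≡ 1ℚ × r ℚ.< q

  0<δa₀² : ∀ δ → 0ℚ ℚ.< δ → 0ℚ ℚ.< δ ℚ.* (a₀ ℚ.* a₀)
  0<δa₀² δ 0<δ = 0<* 0<δ (0<* 0<a₀ 0<a₀)

  near : ∀ δ → 0ℚ ℚ.< δ → (∃[ a ] ∃[ b ] L x a × U x b × b ℚ.< a ℚ.+ δ ℚ.* (a₀ ℚ.* a₀)) →
         ∃[ a ] ∃[ b ] L x a × U x b × a₀ ℚ.≤ a × b ℚ.< a ℚ.+ δ ℚ.* (a₀ ℚ.* a₀)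
  near δ 0<δ (a , b , xa , xb , b<) = [ (λ a₀≤a → a , b , xa , xb , a₀≤a , b<)
    , (λ a≤a₀ → a₀ , b , xa₀ , xb , ℚ.≤-refl , ℚ.<-≤-trans b< (ℚ.+-monoˡ-≤ (δ ℚ.* (a₀ ℚ.* a₀)) a≤a₀))
    ]′ (ℚ.≤-total a₀ a)

  invert : ∀ δ → 0ℚ ℚ.< δ →
           (∃[ a ] ∃[ b ] L x a × U x b × a₀ ℚ.≤ a × b ℚ.< a ℚ.+ δ ℚ.* (a₀ ℚ.* a₀)) →
           ∃[ p ] ∃[ q ] L⁻¹ p × U⁻¹ q × q ℚ.< p ℚ.+ δ
  invert δ 0<δ (a , b , xa , xb , a₀≤a , b<) = finish (inverse 0<a) (inverse 0<b)
    where
    0<a : 0ℚ ℚ.< a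
    0<a = ℚ.<-≤-trans 0<a₀ a₀≤a
    a<b : a ℚ.< b
    a<b = L<U x xa xb
    0<b : 0ℚ ℚ.< b
    0<b = ℚ.<-trans 0<a a<b
    b<a+δab : b ℚ.< a ℚ.+ δ ℚ.* (a ℚ.* b)
    b<a+δab = ℚ.<-≤-trans b< (ℚ.+-monoʳ-≤ a
      (δ*-mono 0<a₀ 0<δ a₀≤a (ℚ.≤-trans a₀≤a (ℚ.<⇒≤ a<b))))
    finish : (∃[ r ] a ℚ.* r ≡ 1ℚ) → (∃[ s ] b ℚ.* s ≡ 1ℚ) →
             ∃[ p ] ∃[ q ] L⁻¹ p × U⁻¹ q × q ℚ.< p ℚ.+ δ
    finish (r , ar≡1) (s , bs≡1) = pack (widen (cross δ 0<a 0<b ar≡1 bs≡1 b<a+δab))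
      where
      pack : Widening s r δ → ∃[ p ] ∃[ q ] L⁻¹ p × U⁻¹ q × q ℚ.< p ℚ.+ δ
      pack (p , q , p<s , r<q , q<p+δ) =
        p , q , (b , s , xb , bs≡1 , p<s) , (a , r , 0<a , xa , ar≡1 , r<q) , q<p+δ

-- Adjacency is decidable, as always for a finite graph classically.
record Graph (n : ℕ) : Set₁ where
  field
    Adj        : Rel (Fin n) 0ℓ
    adj?       : Decidable Adj
    adj-sym    : Symmetric Adj
    adj-irrefl : Irreflexive _≡_ Adj

module _ {n : ℕ} (G : Graph n) where
  open Graph G

  Connected : Set
  Connected = ∀ u v → Star Adj u v

  N⟨_⟩ N[_] : Fin n → Subset n
  N⟨ x ⟩ = tabulate (λ y → does (adj? x y))
  N[ x ] = ⁅ x ⁆ ∪ N⟨ x ⟩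

  closedDegree : Fin n → ℕ
  closedDegree x = ∣ N[ x ] ∣

  EmptyBipartite : Subset n → Subset n → Set
  EmptyBipartite X Y = Empty (X ∩ Y) × (∀ u v → u ∈ X → v ∈ Y → ¬ Adj u v)

  -- v₁, …, v_k is indexed from 0.
  record InducedPath (k : ℕ) : Set where
    field
      vertex    : Fin k → Fin n
      injective : Injective _≡_ _≡_ vertex
      induced   : ∀ i j → Adj (vertex i) (vertex j) ⇔ ∣ toℕ i - toℕ j ∣ ≡ 1

  StartsIn : ∀ {k} → InducedPath k → Fin n → Set
  StartsIn {k} P x = Σ[ i ∈ Fin k ] toℕ i ≡ 0 × InducedPath.vertex P i ≡ x

{-# OPTIONS --safe #-}

-- Gyárfás' path argument.  Let D be the maximum closed degree and t the least
-- number such that no empty bipartite graph has both sides larger than t; thus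
-- D ≤ εn and t ≤ cn.  Any W with more than 3t vertices has a component missing
-- at most t vertices of W.  Starting from C = V(G) and v = x, delete N[v] from
-- the connected set C, keep such a component K, and move v to a neighbour y of
-- v in C that touches K, with K ∪ {y} as the new C.  Each step costs at most
-- t + D vertices and extends the induced path by one vertex, so more than
-- 2m(t + D) vertices leave room for m steps.
-- Since D and t do not mention the reals c and ε, the path is built by
-- deciding finite questions only; c and ε enter through rational upper bounds.

module Submission where

open import Defs
open import Data.Nat.Base as ℕ using (ℕ)
open import Data.Fin.Base using (Fin)
open import Data.Fin.Subset using (Subset; ∣_∣)
open import Data.Product using (_×_; ∃-syntax; Σ-syntax)
open import Relation.Nullary using (¬_)

open import Data.Bool.Base using (true; false)
open import Data.Empty using (⊥-elim)
open import Data.Fin.Base using (zero; suc; toℕ)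
open import Data.Fin.Properties using (any?; all?; toℕ-injective)
open import Data.Fin.Subset using (_∈_; _∉_; _⊆_; _∩_; _∪_; _─_; ⁅_⁆; ⊤; Nonempty)
open import Data.Fin.Subset.Properties using (_∈?_; anySubset?; nonempty?; ∈⊤; ∣⊤∣≡n; ∣p∣≤n; x∈⁅x⁆; x∈⁅y⁆⇒x≡y; ∣⁅x⁆∣≡1; p∩q⊆p; p∩q⊆q; x∈p∩q⁺; x∈p∩q⁻; p⊆p∪q; q⊆p∪q; x∈p∪q⁻; ∣p∩q∣≤∣q∣; ∣p∣≤∣p∪q∣; p─q⊆p; x∈p∧x∉q⇒x∈p─q; p∩q≢∅⇒∣p─q∣<∣p∣; p⊂q⇒∣p∣<∣q∣)
open import Data.Integer.Base using (+_)
import Data.Integer.Base as ℤ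
import Data.Integer.Properties as ℤ
open import Data.Nat.DivMod using (_/_; m/n*n≤m; m≡m%n+[m/n]*n; m%n<n)
import Data.Nat.Properties as ℕ
open import Data.Nat.Solver using () renaming (module +-*-Solver to ℕ-Solver)
open import Data.Product using (_,_; proj₂)
open import Data.Rational.Base as ℚ using (ℚ; 0ℚ; 1ℚ; ½; toℚᵘ; positive; nonNegative)
import Data.Rational.Properties as ℚ
open import Data.Rational.Solver using () renaming (module +-*-Solver to ℚ-Solver)
open import Data.Rational.Unnormalised.Base as ℚᵘ using (mkℚᵘ; *≡*; *≤*)
import Data.Rational.Unnormalised.Properties as ℚᵘ
open import Data.Sum.Base using (_⊎_; inj₁; inj₂)
open import Data.Vec.Base using ([]; _∷_; here; there)
open import Data.Vec.Properties using (lookup∘tabulate; []=⇒lookup; lookup⇒[]=)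
open import Function.Base using (_∘_)
open import Function.Bundles using (mk⇔)
open import Relation.Binary.Construct.Closure.ReflexiveTransitive using (Star; _◅_) renaming (ε to nil)
open import Relation.Binary.PropositionalEquality using (_≡_; _≢_; refl; sym; trans; cong; cong₂; subst)
open import Relation.Nullary using (Dec; yes; no; contradiction)
open import Relation.Nullary.Decidable using (_×-dec_; _→-dec_; ¬?; decidable-stable; dec-true)

private
  variable
    n : ℕ

-- Cardinalities of finite subsets, and a maximum.

∣p∣≡∣p∩q∣+∣p─q∣ : (p q : Subset n) → ∣ p ∣ ≡ ∣ p ∩ q ∣ ℕ.+ ∣ p ─ q ∣
∣p∣≡∣p∩q∣+∣p─q∣ []          []          = refl
∣p∣≡∣p∩q∣+∣p─q∣ (true  ∷ p) (true  ∷ q) = cong ℕ.suc (∣p∣≡∣p∩q∣+∣p─q∣ p q)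
∣p∣≡∣p∩q∣+∣p─q∣ (true  ∷ p) (false ∷ q) =
  trans (cong ℕ.suc (∣p∣≡∣p∩q∣+∣p─q∣ p q)) (sym (ℕ.+-suc ∣ p ∩ q ∣ ∣ p ─ q ∣))
∣p∣≡∣p∩q∣+∣p─q∣ (false ∷ p) (true  ∷ q) = ∣p∣≡∣p∩q∣+∣p─q∣ p q
∣p∣≡∣p∩q∣+∣p─q∣ (false ∷ p) (false ∷ q) = ∣p∣≡∣p∩q∣+∣p─q∣ p q

x∈p─q⇒x∉q : ∀ {x} (p q : Subset n) → x ∈ p ─ q → x ∉ q
x∈p─q⇒x∉q (_     ∷ p) (true  ∷ q) (there h) (there k) = x∈p─q⇒x∉q p q h k
x∈p─q⇒x∉q (_     ∷ p) (false ∷ q) (there h) (there k) = x∈p─q⇒x∉q p q h k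

0<∣p∣⇒Nonempty : (p : Subset n) → 0 ℕ.< ∣ p ∣ → Nonempty p
0<∣p∣⇒Nonempty (true  ∷ p) _ = zero , here
0<∣p∣⇒Nonempty (false ∷ p) h = let (x , x∈p) = 0<∣p∣⇒Nonempty p h in suc x , there x∈p

maximum : (f : Fin (ℕ.suc n) → ℕ) → ∃[ i ] (∀ j → f j ℕ.≤ f i)
maximum {ℕ.zero}  f = zero , λ { zero → ℕ.≤-refl }
maximum {ℕ.suc n} f with maximum (f ∘ suc)
... | i , f≤fi with ℕ.≤-total (f zero) (f (suc i))
... | inj₁ f0≤fi = suc i , λ { zero → f0≤fi ; (suc j) → f≤fi j }
... | inj₂ fi≤f0 = zero  , λ { zero → ℕ.≤-refl ; (suc j) → ℕ.≤-trans (f≤fi j) fi≤f0 }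

module _ {n : ℕ} (G : Graph n) where
  open Graph G

  -- Neighbourhoods and closed degrees.

  ∈N⟨⟩⁺ : ∀ {x y} → Adj x y → y ∈ N⟨_⟩ G x
  ∈N⟨⟩⁺ {x} {y} xy =
    lookup⇒[]= y _ (trans (lookup∘tabulate _ y) (dec-true (adj? x y) xy))

  ∈N⟨⟩⁻ : ∀ {x y} → y ∈ N⟨_⟩ G x → Adj x y
  ∈N⟨⟩⁻ {x} {y} h with adj? x y | trans (sym (lookup∘tabulate _ y)) ([]=⇒lookup h)
  ... | yes xy | _ = xy
  ... | no _   | ()

  x∈N[x] : ∀ x → x ∈ N[_] G x
  x∈N[x] x = p⊆p∪q (N⟨_⟩ G x) (x∈⁅x⁆ x)

  Adj⇒∈N[] : ∀ {x y} → Adj x y → y ∈ N[_] G x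
  Adj⇒∈N[] {x} xy = q⊆p∪q ⁅ x ⁆ (N⟨_⟩ G x) (∈N⟨⟩⁺ xy)

  ∈N[]⇒Adj : ∀ {x y} → y ∈ N[_] G x → y ≢ x → Adj x y
  ∈N[]⇒Adj {x} h y≢x with x∈p∪q⁻ ⁅ x ⁆ (N⟨_⟩ G x) h
  ... | inj₁ y∈⁅x⁆ = contradiction (x∈⁅y⁆⇒x≡y x y∈⁅x⁆) y≢x
  ... | inj₂ y∈N   = ∈N⟨⟩⁻ y∈N

  0<closedDegree : ∀ x → 0 ℕ.< closedDegree G x
  0<closedDegree x = ℕ.≤-trans (ℕ.≤-reflexive (sym (∣⁅x⁆∣≡1 x))) (∣p∣≤∣p∪q∣ ⁅ x ⁆ (N⟨_⟩ G x))

  -- Cuts and connected vertex sets.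

  CrossingEdge : Subset n → Subset n → Set
  CrossingEdge C A = ∃[ u ] ∃[ w ] (u ∈ C × u ∈ A) × (w ∈ C × w ∉ A) × Adj u w

  crossingEdge? : ∀ C A → Dec (CrossingEdge C A)
  crossingEdge? C A = any? λ u → any? λ w →
    (u ∈? C ×-dec u ∈? A) ×-dec (w ∈? C ×-dec ¬? (w ∈? A)) ×-dec adj? u w

  -- Connectedness of G[C] through cuts, which avoids walks inside C.
  ConnectedSet : Subset n → Set
  ConnectedSet C = ∀ A {a b} → a ∈ C → a ∈ A → b ∈ C → b ∉ A → CrossingEdge C A

  connected⇒connectedSet-⊤ : Connected G → ConnectedSet ⊤
  connected⇒connectedSet-⊤ connected A {a} {b} _ a∈A _ b∉A = go a∈A (connected a b)
    where
    go : ∀ {u} → u ∈ A → Star Adj u b → CrossingEdge ⊤ A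
    go u∈A nil = contradiction u∈A b∉A
    go {u} u∈A (_◅_ {j = w} uw rest) with w ∈? A
    ... | yes w∈A = go w∈A rest
    ... | no  w∉A = u , w , (∈⊤ , u∈A) , (∈⊤ , w∉A) , uw

  -- If the cut separates `u` from `y`, the edge `uy` crosses it. Otherwise the vertex among `a`,
  -- `b` on the other side from `y` lies in `K`, so the cut already splits `K`.
  connectedSet-insert : ∀ {K u y} → ConnectedSet K → u ∈ K → Adj u y → ConnectedSet (K ∪ ⁅ y ⁆)
  connectedSet-insert {K} {u} {y} K-conn u∈K uy A {a} {b} a∈K′ a∈A b∈K′ b∉A = go (u ∈? A) (y ∈? A)
    where
    K⊆K′ : K ⊆ K ∪ ⁅ y ⁆
    K⊆K′ = p⊆p∪q ⁅ y ⁆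
    y∈K′ : y ∈ K ∪ ⁅ y ⁆
    y∈K′ = q⊆p∪q K ⁅ y ⁆ (x∈⁅x⁆ y)
    lift : CrossingEdge K A → CrossingEdge (K ∪ ⁅ y ⁆) A
    lift (u , w , (u∈K , u∈A) , (w∈K , w∉A) , uw) =
      u , w , (K⊆K′ u∈K , u∈A) , (K⊆K′ w∈K , w∉A) , uw
    ∈K : ∀ {z} → z ∈ K ∪ ⁅ y ⁆ → z ≢ y → z ∈ K
    ∈K z∈K′ z≢y with x∈p∪q⁻ K ⁅ y ⁆ z∈K′
    ... | inj₁ z∈K = z∈K
    ... | inj₂ z∈y = contradiction (x∈⁅y⁆⇒x≡y y z∈y) z≢y
    go : Dec (u ∈ A) → Dec (y ∈ A) → CrossingEdge (K ∪ ⁅ y ⁆) A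
    go (yes u∈A) (no  y∉A) = u , y , (K⊆K′ u∈K , u∈A) , (y∈K′ , y∉A) , uy
    go (no  u∉A) (yes y∈A) = y , u , (y∈K′ , y∈A) , (K⊆K′ u∈K , u∉A) , adj-sym uy
    go (yes u∈A) (yes y∈A) = lift (K-conn A u∈K u∈A (∈K b∈K′ λ { refl → b∉A y∈A }) b∉A)
    go (no  u∉A) (no  y∉A) = lift (K-conn A (∈K a∈K′ λ { refl → y∉A a∈A }) a∈A u∈K u∉A)

  Disconnection : Subset n → Subset n → Set
  Disconnection C A = Nonempty (C ∩ A) × Nonempty (C ─ A) × ¬ CrossingEdge C A

  -- A finite search through all subsets `A`; decidability of crossing edges removes the double
  -- negation left when it fails.
  connectedSet-or-disconnection : ∀ C → ConnectedSet C ⊎ (∃[ A ] Disconnection C A)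
  connectedSet-or-disconnection C
    with anySubset? (λ A → nonempty? (C ∩ A) ×-dec nonempty? (C ─ A) ×-dec ¬? (crossingEdge? C A))
  ... | yes disconnection = inj₂ disconnection
  ... | no  none = inj₁ λ A {a} {b} a∈C a∈A b∈C b∉A → decidable-stable (crossingEdge? C A)
    λ ¬e → none (A , (a , x∈p∩q⁺ (a∈C , a∈A)) , (b , x∈p∧x∉q⇒x∈p─q b∈C b∉A) , ¬e)

  -- Components that fill most of a vertex set.

  -- For `K ⊆ W`: `K` is a union of components of `G[W]`.
  ClosedIn : Subset n → Subset n → Set
  ClosedIn W K = ∀ u w → u ∈ K → w ∈ W → w ∉ K → ¬ Adj u w

  NoEmptyBipartiteAbove : ℕ → Set
  NoEmptyBipartiteAbove t = ∀ X Y → t ℕ.< ∣ X ∣ → t ℕ.< ∣ Y ∣ → ¬ EmptyBipartite G X Y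

  -- A component of `G[W]`, encoded as a closed and connected part; it is nonempty by the size bound
  -- once `W` has more than `t` vertices.
  LargeComponent : ℕ → Subset n → Set
  LargeComponent t W = ∃[ K ] K ⊆ W × ClosedIn W K × ConnectedSet K × ∣ W ∣ ℕ.≤ ∣ K ∣ ℕ.+ t

  module _ {t : ℕ} (free : NoEmptyBipartiteAbove t) where

    -- Closedness makes `K` and `W ─ K` an empty bipartite graph, so the second side cannot exceed
    -- `t` as well.
    closed-large : ∀ {W K} → K ⊆ W → ClosedIn W K → t ℕ.< ∣ K ∣ → ∣ W ∣ ℕ.≤ ∣ K ∣ ℕ.+ t
    closed-large {W} {K} K⊆W closed t<K = begin
      ∣ W ∣                        ≡⟨ ∣p∣≡∣p∩q∣+∣p─q∣ W K ⟩
      ∣ W ∩ K ∣ ℕ.+ ∣ W ─ K ∣      ≤⟨ ℕ.+-mono-≤ (∣p∩q∣≤∣q∣ W K) W─K≤t ⟩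
      ∣ K ∣ ℕ.+ t                  ∎
      where
      open ℕ.≤-Reasoning
      empty : EmptyBipartite G K (W ─ K)
      empty = (λ (x , h) →
                let (x∈K , x∈W─K) = x∈p∩q⁻ K (W ─ K) h in x∈p─q⇒x∉q W K x∈W─K x∈K)
            , λ u w u∈K w∈W─K → closed u w u∈K (p─q⊆p W K w∈W─K) (x∈p─q⇒x∉q W K w∈W─K)
      W─K≤t : ∣ W ─ K ∣ ℕ.≤ t
      W─K≤t = ℕ.≮⇒≥ λ t<W─K → free K (W ─ K) t<K t<W─K empty

    -- Shrink a closed K with more than t vertices along a disconnection: closedness
    -- forces ∣ K ∣ > 2t, so one of the two parts is again larger than t.
    large-component : ∀ W → 3 ℕ.* t ℕ.< ∣ W ∣ → LargeComponent t W
    large-component W 3t<W =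
      shrink ∣ W ∣ W ℕ.≤-refl (λ x → x) (λ u w _ w∈W w∉W → contradiction w∈W w∉W)
        (ℕ.≤-<-trans (ℕ.m≤m+n t _) 3t<W)
      where
      shrink : ∀ s K → ∣ K ∣ ℕ.≤ s → K ⊆ W → ClosedIn W K → t ℕ.< ∣ K ∣ →
               LargeComponent t W
      shrink ℕ.zero K K≤0 _ _ t<K = contradiction (ℕ.≤-trans t<K K≤0) λ ()
      shrink (ℕ.suc s) K K≤s K⊆W closed t<K with connectedSet-or-disconnection K
      ... | inj₁ K-conn = K , K⊆W , closed , K-conn , closed-large K⊆W closed t<K
      ... | inj₂ (A , K∩A≢∅ , (b , b∈K─A) , ¬crossing) = go (t ℕ.<? ∣ K ∩ A ∣) (t ℕ.<? ∣ K ─ A ∣)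
        where
        ∣K∩A∣<∣K∣ : ∣ K ∩ A ∣ ℕ.< ∣ K ∣
        ∣K∩A∣<∣K∣ = p⊂q⇒∣p∣<∣q∣ (p∩q⊆p K A , b , p─q⊆p K A b∈K─A
                                  , λ b∈K∩A → x∈p─q⇒x∉q K A b∈K─A (p∩q⊆q K A b∈K∩A))

        ∩-closed : ClosedIn W (K ∩ A)
        ∩-closed u w u∈K∩A w∈W w∉K∩A uw with x∈p∩q⁻ K A u∈K∩A | w ∈? K
        ... | u∈K , u∈A | yes w∈K =
          ¬crossing (u , w , (u∈K , u∈A) , (w∈K , λ w∈A → w∉K∩A (x∈p∩q⁺ (w∈K , w∈A))) , uw)
        ... | u∈K , u∈A | no  w∉K = closed u w u∈K w∈W w∉K uw

        ─-closed : ClosedIn W (K ─ A)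
        ─-closed u w u∈K─A w∈W w∉K─A uw with w ∈? K | w ∈? A
        ... | no  w∉K | _       = closed u w (p─q⊆p K A u∈K─A) w∈W w∉K uw
        ... | yes w∈K | no  w∉A = w∉K─A (x∈p∧x∉q⇒x∈p─q w∈K w∉A)
        ... | yes w∈K | yes w∈A =
          ¬crossing (w , u , (w∈K , w∈A) , (p─q⊆p K A u∈K─A , x∈p─q⇒x∉q K A u∈K─A) , adj-sym uw)

        go : Dec (t ℕ.< ∣ K ∩ A ∣) → Dec (t ℕ.< ∣ K ─ A ∣) → LargeComponent t W
        go (yes t<K∩A) _ =
          shrink s (K ∩ A) (ℕ.≤-pred (ℕ.<-≤-trans ∣K∩A∣<∣K∣ K≤s)) (K⊆W ∘ p∩q⊆p K A) ∩-closed t<K∩A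
        go _ (yes t<K─A) =
          shrink s (K ─ A) (ℕ.≤-pred (ℕ.<-≤-trans (p∩q≢∅⇒∣p─q∣<∣p∣ K A K∩A≢∅) K≤s))
            (K⊆W ∘ p─q⊆p K A) ─-closed t<K─A
        go (no t≮K∩A) (no t≮K─A) = contradiction 3t<W (ℕ.≤⇒≯ (begin
          ∣ W ∣                                  ≤⟨ closed-large K⊆W closed t<K ⟩
          ∣ K ∣ ℕ.+ t                            ≡⟨ cong (ℕ._+ t) (∣p∣≡∣p∩q∣+∣p─q∣ K A) ⟩
          ∣ K ∩ A ∣ ℕ.+ ∣ K ─ A ∣ ℕ.+ t          ≤⟨ ℕ.+-monoˡ-≤ t (ℕ.+-mono-≤ (ℕ.≮⇒≥ t≮K∩A) (ℕ.≮⇒≥ t≮K─A)) ⟩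
          t ℕ.+ t ℕ.+ t                          ≡⟨ solve 1 (λ t → t :+ t :+ t := con 3 :* t) refl t ⟩
          3 ℕ.* t                                ∎))
          where
          open ℕ.≤-Reasoning
          open ℕ-Solver

  -- Induced paths confined to a vertex set.

  -- Confinement to `C` is recorded so that a vertex put in front can be kept away from the whole
  -- path.
  PathIn : ℕ → Subset n → Fin n → Set
  PathIn k C x = Σ[ P ∈ InducedPath G k ] StartsIn G P x × (∀ i → InducedPath.vertex P i ∈ C)

  singleton : ∀ {C x} → x ∈ C → PathIn 1 C x
  singleton {x = x} x∈C =
    record
      { vertex    = λ _ → x
      ; injective = λ { {zero} {zero} _ → refl }
      ; induced   = λ { zero zero → mk⇔ (λ xx → ⊥-elim (adj-irrefl refl xx)) (λ ()) }
      }
    , (zero , refl , refl) , λ _ → x∈C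

  -- `v ∉ C′` keeps the vertices distinct, and `v` gets no chord because its only neighbour in `C′`
  -- is the first vertex `y` of the old path.
  prepend : ∀ {k C C′ v y} → v ∈ C → C′ ⊆ C → v ∉ C′ → Adj v y →
            (∀ {w} → w ∈ C′ → Adj v w → w ≡ y) →
            PathIn k C′ y → PathIn (ℕ.suc k) C v
  prepend {k} {C} {C′} {v} {y} v∈C C′⊆C v∉C′ vy only-y (P , (i₀ , i₀≡0 , P₀≡y) , P⊆C′) =
    record { vertex = vertex′ ; injective = injective′ ; induced = induced′ }
    , (zero , refl , refl) , λ { zero → v∈C ; (suc i) → C′⊆C (P⊆C′ i) }
    where
    open InducedPath P
    vertex′ : Fin (ℕ.suc k) → Fin n
    vertex′ zero    = v
    vertex′ (suc i) = vertex i

    injective′ : ∀ {i j} → vertex′ i ≡ vertex′ j → i ≡ j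
    injective′ {zero}  {zero}  _ = refl
    injective′ {zero}  {suc j} e = contradiction (subst (_∈ C′) (sym e) (P⊆C′ j)) v∉C′
    injective′ {suc i} {zero}  e = contradiction (subst (_∈ C′) e (P⊆C′ i)) v∉C′
    injective′ {suc i} {suc j} e = cong suc (injective e)

    adj⇒first : ∀ j → Adj v (vertex j) → ℕ.suc (toℕ j) ≡ 1
    adj⇒first j vj = cong ℕ.suc (trans (cong toℕ (injective (trans (only-y (P⊆C′ j) vj) (sym P₀≡y)))) i₀≡0)

    first⇒adj : ∀ j → ℕ.suc (toℕ j) ≡ 1 → Adj v (vertex j)
    first⇒adj j j≡0 =
      subst (Adj v) (trans (sym P₀≡y) (cong vertex (toℕ-injective (trans i₀≡0 (sym (ℕ.suc-injective j≡0)))))) vy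

    induced′ : ∀ i j → _
    induced′ zero    zero    = mk⇔ (λ vv → ⊥-elim (adj-irrefl refl vv)) (λ ())
    induced′ zero    (suc j) = mk⇔ (adj⇒first j) (first⇒adj j)
    induced′ (suc i) zero    = mk⇔ (adj⇒first i ∘ adj-sym) (adj-sym ∘ first⇒adj i)
    induced′ (suc i) (suc j) = induced i j

  -- The cut `⁅ v ⁆` of `C` is crossed by an edge, and that edge is the path.
  edge-path : ∀ {C v} → ConnectedSet C → v ∈ C → 1 ℕ.< ∣ C ∣ → PathIn 2 C v
  edge-path {C} {v} C-conn v∈C 1<C =
    let (w , w∈C─v) = other
    in extend (C-conn ⁅ v ⁆ v∈C (x∈⁅x⁆ v) (p─q⊆p C ⁅ v ⁆ w∈C─v) (x∈p─q⇒x∉q C ⁅ v ⁆ w∈C─v))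
    where
    other : Nonempty (C ─ ⁅ v ⁆)
    other = 0<∣p∣⇒Nonempty (C ─ ⁅ v ⁆) (ℕ.+-cancelˡ-< 1 0 _ (ℕ.<-≤-trans 1<C
      (ℕ.≤-trans (ℕ.≤-reflexive (∣p∣≡∣p∩q∣+∣p─q∣ C ⁅ v ⁆))
        (ℕ.+-monoˡ-≤ _ (ℕ.≤-trans (∣p∩q∣≤∣q∣ C ⁅ v ⁆) (ℕ.≤-reflexive (∣⁅x⁆∣≡1 v)))))))
    extend : CrossingEdge C ⁅ v ⁆ → PathIn 2 C v
    extend (u , w , (_ , u∈v) , (w∈C , w∉v) , uw) with x∈⁅y⁆⇒x≡y v u∈v
    ... | refl = prepend v∈C (λ h → subst (_∈ C) (sym (x∈⁅y⁆⇒x≡y w h)) w∈C)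
                   (λ h → w∉v (subst (_∈ ⁅ v ⁆) (x∈⁅y⁆⇒x≡y w h) (x∈⁅x⁆ v)))
                   uw (λ h _ → x∈⁅y⁆⇒x≡y w h) (singleton (x∈⁅x⁆ w))

  -- The extension step and its iteration.

  module _ {t D : ℕ} (free : NoEmptyBipartiteAbove t) (deg≤D : ∀ x → closedDegree G x ℕ.≤ D) where

    Extension : Subset n → Fin n → Set
    Extension C v = ∃[ C′ ] ∃[ y ]
      C′ ⊆ C × v ∉ C′ × y ∈ C′ × Adj v y × (∀ {w} → w ∈ C′ → Adj v w → w ≡ y) ×
      ConnectedSet C′ × ∣ C ∣ ℕ.≤ ∣ C′ ∣ ℕ.+ (t ℕ.+ D)

    -- `K` avoids `v`, so connectedness of `C` yields an edge `uy` leaving `K`. As `K` is closed in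
    -- `W`, its end `y` lies in `N[v]`, and `y ≠ v` because `u` lies outside `N[v]`.
    step : ∀ {C v} → ConnectedSet C → v ∈ C → 3 ℕ.* t ℕ.+ D ℕ.< ∣ C ∣ → Extension C v
    step {C} {v} C-conn v∈C 3t+D<C = next (large-component free W 3t<W)
      where
      open ℕ.≤-Reasoning
      W : Subset n
      W = C ─ N[_] G v

      C≤W+D : ∣ C ∣ ℕ.≤ ∣ W ∣ ℕ.+ D
      C≤W+D = begin
        ∣ C ∣                                ≡⟨ ∣p∣≡∣p∩q∣+∣p─q∣ C (N[_] G v) ⟩
        ∣ C ∩ N[_] G v ∣ ℕ.+ ∣ W ∣           ≤⟨ ℕ.+-monoˡ-≤ ∣ W ∣ (ℕ.≤-trans (∣p∩q∣≤∣q∣ C (N[_] G v)) (deg≤D v)) ⟩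
        D ℕ.+ ∣ W ∣                          ≡⟨ ℕ.+-comm D ∣ W ∣ ⟩
        ∣ W ∣ ℕ.+ D                          ∎

      3t<W : 3 ℕ.* t ℕ.< ∣ W ∣
      3t<W = ℕ.+-cancelʳ-< D _ _ (ℕ.<-≤-trans 3t+D<C C≤W+D)

      W∌N[v] : ∀ {w} → w ∈ W → w ∉ N[_] G v
      W∌N[v] = x∈p─q⇒x∉q C (N[_] G v)

      next : LargeComponent t W → Extension C v
      next (K , K⊆W , closed , K-conn , W≤K+t) = attach (C-conn K (p─q⊆p C _ (K⊆W k∈K)) k∈K v∈C v∉K)
        where
        -- From `3t < ∣W∣ ≤ ∣K∣ + t`.
        K≢∅ : Nonempty K
        K≢∅ = 0<∣p∣⇒Nonempty K (ℕ.+-cancelʳ-< t 0 ∣ K ∣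
                (ℕ.≤-<-trans (ℕ.m≤m+n t _) (ℕ.<-≤-trans 3t<W W≤K+t)))
        k∈K = proj₂ K≢∅

        v∉K : v ∉ K
        v∉K v∈K = W∌N[v] (K⊆W v∈K) (x∈N[x] v)

        attach : CrossingEdge C K → Extension C v
        attach (u , y , (u∈C , u∈K) , (y∈C , y∉K) , uy) =
          K ∪ ⁅ y ⁆ , y , K′⊆C , v∉K′ , q⊆p∪q K ⁅ y ⁆ (x∈⁅x⁆ y) , ∈N[]⇒Adj y∈N[v] y≢v , only-y
          , connectedSet-insert K-conn u∈K uy , size
          where
          y≢v : y ≢ v
          y≢v refl = W∌N[v] (K⊆W u∈K) (Adj⇒∈N[] (adj-sym uy))
          y∈N[v] : y ∈ N[_] G v
          y∈N[v] = decidable-stable (y ∈? N[_] G v) λ y∉N →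
            closed u y u∈K (x∈p∧x∉q⇒x∈p─q y∈C y∉N) y∉K uy
          K′⊆C : K ∪ ⁅ y ⁆ ⊆ C
          K′⊆C w∈K′ with x∈p∪q⁻ K ⁅ y ⁆ w∈K′
          ... | inj₁ w∈K = p─q⊆p C _ (K⊆W w∈K)
          ... | inj₂ w∈y = subst (_∈ C) (sym (x∈⁅y⁆⇒x≡y y w∈y)) y∈C
          v∉K′ : v ∉ K ∪ ⁅ y ⁆
          v∉K′ v∈K′ with x∈p∪q⁻ K ⁅ y ⁆ v∈K′
          ... | inj₁ v∈K = v∉K v∈K
          ... | inj₂ v∈y = y≢v (sym (x∈⁅y⁆⇒x≡y y v∈y))
          only-y : ∀ {w} → w ∈ K ∪ ⁅ y ⁆ → Adj v w → w ≡ y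
          only-y w∈K′ vw with x∈p∪q⁻ K ⁅ y ⁆ w∈K′
          ... | inj₁ w∈K = contradiction (Adj⇒∈N[] vw) (W∌N[v] (K⊆W w∈K))
          ... | inj₂ w∈y = x∈⁅y⁆⇒x≡y y w∈y
          size : ∣ C ∣ ℕ.≤ ∣ K ∪ ⁅ y ⁆ ∣ ℕ.+ (t ℕ.+ D)
          size = begin
            ∣ C ∣                               ≤⟨ C≤W+D ⟩
            ∣ W ∣ ℕ.+ D                         ≤⟨ ℕ.+-monoˡ-≤ D W≤K+t ⟩
            ∣ K ∣ ℕ.+ t ℕ.+ D                   ≡⟨ ℕ.+-assoc ∣ K ∣ t D ⟩
            ∣ K ∣ ℕ.+ (t ℕ.+ D)                 ≤⟨ ℕ.+-monoˡ-≤ (t ℕ.+ D) (∣p∣≤∣p∪q∣ K ⁅ y ⁆) ⟩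
            ∣ K ∪ ⁅ y ⁆ ∣ ℕ.+ (t ℕ.+ D)         ∎

    -- A round costs only `t + D`; the doubled budget secures the `3t + D` that `step` demands while
    -- at least two rounds remain.
    long-path : ∀ m {C v} → ConnectedSet C → v ∈ C → m ℕ.* (2 ℕ.* (t ℕ.+ D)) ℕ.< ∣ C ∣ →
                PathIn (ℕ.suc m) C v
    long-path 0 _ v∈C _ = singleton v∈C
    -- The last round is separate: if `t > D`, then `2(t + D)` falls short of the `3t + D` that
    -- `step` demands. One edge at `v` is enough here.
    long-path 1 {C} {v} C-conn v∈C 2s<C = edge-path C-conn v∈C (ℕ.≤-<-trans (begin
        1                          ≤⟨ 0<closedDegree v ⟩
        closedDegree G v           ≤⟨ deg≤D v ⟩
        D                          ≤⟨ ℕ.m≤n+m D t ⟩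
        t ℕ.+ D                    ≤⟨ ℕ.m≤m+n _ _ ⟩
        2 ℕ.* (t ℕ.+ D)            ≤⟨ ℕ.m≤m+n _ _ ⟩
        1 ℕ.* (2 ℕ.* (t ℕ.+ D))    ∎) 2s<C)
      where open ℕ.≤-Reasoning
    long-path (ℕ.suc m@(ℕ.suc m′)) {C} {v} C-conn v∈C large =
      let (C′ , y , C′⊆C , v∉C′ , y∈C′ , vy , only-y , C′-conn , C≤C′+s) = step C-conn v∈C enough
          large′ = ℕ.+-cancelʳ-< (t ℕ.+ D) _ _ (ℕ.≤-<-trans remaining (ℕ.<-≤-trans large C≤C′+s))
      in prepend v∈C C′⊆C v∉C′ vy only-y (long-path m C′-conn y∈C′ large′)
      where
      open ℕ.≤-Reasoning
      open ℕ-Solver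
      remaining : m ℕ.* (2 ℕ.* (t ℕ.+ D)) ℕ.+ (t ℕ.+ D) ℕ.≤ ℕ.suc m ℕ.* (2 ℕ.* (t ℕ.+ D))
      remaining = begin
        m ℕ.* (2 ℕ.* (t ℕ.+ D)) ℕ.+ (t ℕ.+ D)         ≤⟨ ℕ.+-monoʳ-≤ (m ℕ.* (2 ℕ.* (t ℕ.+ D))) (ℕ.m≤m+n (t ℕ.+ D) _) ⟩
        m ℕ.* (2 ℕ.* (t ℕ.+ D)) ℕ.+ 2 ℕ.* (t ℕ.+ D)   ≡⟨ ℕ.+-comm (m ℕ.* (2 ℕ.* (t ℕ.+ D))) _ ⟩
        ℕ.suc m ℕ.* (2 ℕ.* (t ℕ.+ D))                 ∎
      enough : 3 ℕ.* t ℕ.+ D ℕ.< ∣ C ∣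
      enough = ℕ.≤-<-trans (begin
        3 ℕ.* t ℕ.+ D                                         ≤⟨ ℕ.m≤m+n _ _ ⟩
        -- The added term is `(m′ + 2) · 2(t + D)` minus `3t + D`.
        3 ℕ.* t ℕ.+ D ℕ.+ (t ℕ.+ 3 ℕ.* D ℕ.+ m′ ℕ.* (2 ℕ.* (t ℕ.+ D)))
          ≡⟨ solve 3 (λ t D m → con 3 :* t :+ D :+ (t :+ con 3 :* D :+ m :* (con 2 :* (t :+ D)))
                              := (con 2 :+ m) :* (con 2 :* (t :+ D))) refl t D m′ ⟩
        ℕ.suc m ℕ.* (2 ℕ.* (t ℕ.+ D))                         ∎) large

  -- The least threshold `t`.

  EmptyBipartiteAbove : ℕ → Set
  EmptyBipartiteAbove t = ∃[ X ] ∃[ Y ] t ℕ.< ∣ X ∣ × t ℕ.< ∣ Y ∣ × EmptyBipartite G X Y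

  emptyBipartiteAbove? : ∀ t → Dec (EmptyBipartiteAbove t)
  emptyBipartiteAbove? t = anySubset? λ X → anySubset? λ Y →
    t ℕ.<? ∣ X ∣ ×-dec t ℕ.<? ∣ Y ∣ ×-dec ¬? (nonempty? (X ∩ Y)) ×-dec
    all? λ u → all? λ v → u ∈? X →-dec (v ∈? Y →-dec ¬? (adj? u v))

  -- The search descends from `n`, which no subset exceeds in size. The pair found just below a
  -- positive `t` is what later gives `t ≤ cn`.
  least-threshold : ∃[ t ] NoEmptyBipartiteAbove t × (∀ {s} → t ≡ ℕ.suc s → EmptyBipartiteAbove s)
  least-threshold = search n λ X Y n<X → contradiction (∣p∣≤n X) (ℕ.<⇒≱ n<X)
    where
    search : ∀ t → NoEmptyBipartiteAbove t →
             ∃[ t ] NoEmptyBipartiteAbove t × (∀ {s} → t ≡ ℕ.suc s → EmptyBipartiteAbove s)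
    search ℕ.zero    free = 0 , free , λ ()
    search (ℕ.suc t) free with emptyBipartiteAbove? t
    ... | yes e = ℕ.suc t , free , λ { refl → e }
    ... | no ¬e = search t λ X Y t<X t<Y e → ¬e (X , Y , t<X , t<Y , e)

-- Natural numbers as rationals.

module _ where
  open ℝ

  ι : ℕ → ℚ
  ι m = + m ℚ./ 1

  -- Unnormalised fractions avoid the gcd in `ι m`; the `0` encodes denominator one.
  ι≃ : ∀ m → toℚᵘ (ι m) ℚᵘ.≃ mkℚᵘ (+ m) 0
  ι≃ m = ℚ.toℚᵘ-fromℚᵘ (mkℚᵘ (+ m) 0)

  ι-+ : ∀ a b → ι (a ℕ.+ b) ≡ ι a ℚ.+ ι b
  ι-+ a b = ℚ.toℚᵘ-injective (begin
    toℚᵘ (ι (a ℕ.+ b))                    ≈⟨ ι≃ (a ℕ.+ b) ⟩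
    mkℚᵘ (+ (a ℕ.+ b)) 0                  ≈⟨ *≡* (cong (ℤ._* + 1) (sym (cong₂ ℤ._+_ (ℤ.*-identityʳ (+ a)) (ℤ.*-identityʳ (+ b))))) ⟩
    mkℚᵘ (+ a) 0 ℚᵘ.+ mkℚᵘ (+ b) 0        ≈⟨ ℚᵘ.+-cong (ι≃ a) (ι≃ b) ⟨
    toℚᵘ (ι a) ℚᵘ.+ toℚᵘ (ι b)            ≈⟨ ℚ.toℚᵘ-homo-+ (ι a) (ι b) ⟨
    toℚᵘ (ι a ℚ.+ ι b)                    ∎)
    where open ℚᵘ.≃-Reasoning

  ι-* : ∀ a b → ι (a ℕ.* b) ≡ ι a ℚ.* ι b
  ι-* a b = ℚ.toℚᵘ-injective (begin
    toℚᵘ (ι (a ℕ.* b))                    ≈⟨ ι≃ (a ℕ.* b) ⟩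
    mkℚᵘ (+ (a ℕ.* b)) 0                  ≈⟨ *≡* (cong (ℤ._* + 1) (ℤ.pos-* a b)) ⟩
    mkℚᵘ (+ a) 0 ℚᵘ.* mkℚᵘ (+ b) 0        ≈⟨ ℚᵘ.*-cong (ι≃ a) (ι≃ b) ⟨
    toℚᵘ (ι a) ℚᵘ.* toℚᵘ (ι b)            ≈⟨ ℚ.toℚᵘ-homo-* (ι a) (ι b) ⟨
    toℚᵘ (ι a ℚ.* ι b)                    ∎)
    where open ℚᵘ.≃-Reasoning

  ι-mono : ∀ {a b} → a ℕ.≤ b → ι a ℚ.≤ ι b
  ι-mono {a} {b} a≤b = ℚ.toℚᵘ-cancel-≤ (begin
    toℚᵘ (ι a)     ≃⟨ ι≃ a ⟩
    mkℚᵘ (+ a) 0   ≤⟨ *≤* (ℤ.*-monoʳ-≤-nonNeg (+ 1) (ℤ.+≤+ a≤b)) ⟩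
    mkℚᵘ (+ b) 0   ≃⟨ ι≃ b ⟨
    toℚᵘ (ι b)     ∎)
    where open ℚᵘ.≤-Reasoning

  0≤ι : ∀ m → 0ℚ ℚ.≤ ι m
  0≤ι m = ι-mono {0} {m} ℕ.z≤n

  ι*-mono : ∀ m {p q} → p ℚ.≤ q → ι m ℚ.* p ℚ.≤ ι m ℚ.* q
  ι*-mono m = ℚ.*-monoˡ-≤-nonNeg (ι m) {{nonNegative (0≤ι m)}}

  ι-suc-* : ∀ m q → ι (ℕ.suc m) ℚ.* q ≡ q ℚ.+ ι m ℚ.* q
  ι-suc-* m q = trans (cong (ℚ._* q) (ι-+ 1 m))
    (solve 2 (λ i q → (con 1ℚ :+ i) :* q := q :+ i :* q) refl (ι m) q)
    where open ℚ-Solver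

  -- Natural multiples and positivity of Dedekind reals.

  L-·-≤ : ∀ m x {q b} → L (m · x) q → U x b → q ℚ.≤ ι m ℚ.* b
  L-·-≤ ℕ.zero    x {b = b} q<0 _ = subst (_ ℚ.≤_) (sym (ℚ.*-zeroˡ b)) (ℚ.<⇒≤ q<0)
  L-·-≤ (ℕ.suc m) x {q} {b} (a , a′ , xa , mxa′ , q<a+a′) xb = begin
    q                        ≤⟨ ℚ.<⇒≤ q<a+a′ ⟩
    a ℚ.+ a′                 ≤⟨ ℚ.+-mono-≤ (ℚ.<⇒≤ (L<U x xa xb)) (L-·-≤ m x mxa′ xb) ⟩
    b ℚ.+ ι m ℚ.* b          ≡⟨ ι-suc-* m b ⟨
    ι (ℕ.suc m) ℚ.* b        ∎
    where open ℚ.≤-Reasoning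

  -- The summands come with different upper bounds of `x`; the smallest serves for all of them.
  U-·⁻ : ∀ m x {u} → U (m · x) u → ∃[ a ] U x a × ι m ℚ.* a ℚ.≤ u
  U-·⁻ ℕ.zero x 0<u =
    -- The empty sum provides no upper bound of `x`, so locatedness with tolerance 1 supplies one.
    let (_ , a , _ , xa , _) = located x 1ℚ (ℚ.positive⁻¹ 1ℚ)
    in a , xa , subst (ℚ._≤ _) (sym (ℚ.*-zeroˡ a)) (ℚ.<⇒≤ 0<u)
  U-·⁻ (ℕ.suc m) x {u} (a , b , xa , mxb , a+b<u) with U-·⁻ m x mxb
  ... | a′ , xa′ , ma′≤b with ℚ.≤-total a a′
  ... | inj₁ a≤a′ = a , xa , (begin
    ι (ℕ.suc m) ℚ.* a     ≡⟨ ι-suc-* m a ⟩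
    a ℚ.+ ι m ℚ.* a       ≤⟨ ℚ.+-monoʳ-≤ a (ι*-mono m a≤a′) ⟩
    a ℚ.+ ι m ℚ.* a′      ≤⟨ ℚ.+-monoʳ-≤ a ma′≤b ⟩
    a ℚ.+ b               ≤⟨ ℚ.<⇒≤ a+b<u ⟩
    u                     ∎)
    where open ℚ.≤-Reasoning
  ... | inj₂ a′≤a = a′ , xa′ , (begin
    ι (ℕ.suc m) ℚ.* a′    ≡⟨ ι-suc-* m a′ ⟩
    a′ ℚ.+ ι m ℚ.* a′     ≤⟨ ℚ.+-mono-≤ a′≤a ma′≤b ⟩
    a ℚ.+ b               ≤⟨ ℚ.<⇒≤ a+b<u ⟩
    u                     ∎)
    where open ℚ.≤-Reasoning

  -- If the lower bound `a` of the first summand is not positive, the lower bound `b` of the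
  -- remaining sum must be.
  0<·⇒0< : ∀ m x → 0ℝ < m · x → 0ℝ < x
  0<·⇒0< ℕ.zero x (_ , 0<q , q<0) = contradiction (ℚ.<-trans 0<q q<0) (ℚ.<-irrefl refl)
  0<·⇒0< (ℕ.suc m) x (q , 0<q , a , b , xa , mxb , q<a+b) with 0ℚ ℚ.<? a
  ... | yes 0<a = a , 0<a , xa
  ... | no  0≮a = 0<·⇒0< m x (b , ℚ.<-≤-trans (ℚ.<-trans 0<q q<a+b) a+b≤b , mxb)
    where
    a+b≤b : a ℚ.+ b ℚ.≤ b
    a+b≤b = subst (a ℚ.+ b ℚ.≤_) (ℚ.+-identityˡ b) (ℚ.+-monoˡ-≤ b (ℚ.≮⇒≥ 0≮a))

  0<⇒0≤ : ∀ x → 0ℝ < x → 0ℝ ≤ x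
  0<⇒0≤ x (a , 0<a , xa) q q<0 = L-lower x (ℚ.<-trans q<0 0<a) xa

  0<+0≤ : ∀ x y → 0ℝ < x → 0ℝ ≤ y → 0ℝ < x + y
  0<+0≤ x y (a , 0<a , xa) 0≤y =
    let (q , 0<q , q<a)    = ℚ.<-dense 0<a
        (a′ , a<a′ , xa′)  = L-open x xa
    -- Raising `a` to `a′` leaves the negative rational `a - a′` as a lower bound of `y`; the two
    -- add up to `a`.
    in q , 0<q , a′ , a ℚ.- a′ , xa′
       , 0≤y (a ℚ.- a′) (subst (a ℚ.- a′ ℚ.<_) (ℚ.+-inverseʳ a′) (ℚ.+-monoˡ-< (ℚ.- a′) a<a′))
       , subst (q ℚ.<_) (solve 2 (λ a b → a := b :+ (a :- b)) refl a a′) q<a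
    where open ℚ-Solver

  0≤⇒U-nonNeg : ∀ x {b} → 0ℝ ≤ x → U x b → 0ℚ ℚ.≤ b
  0≤⇒U-nonNeg x {b} 0≤x xb = ℚ.≮⇒≥ λ b<0 → ℚ.<-irrefl refl (L<U x (0≤x b b<0) xb)

  0<2· : ∀ x → 0ℝ < x → 0ℝ < 2 · x
  0<2· x 0<x = 0<+0≤ x (x + 0ℝ) 0<x (0<⇒0≤ (x + 0ℝ) (0<+0≤ x 0ℝ 0<x (λ _ h → h)))

  -- Otherwise a rational strictly between `ι m * b` and `ι d` would be a lower bound of `m · x`
  -- that is too large.
  fromℕ≤· : ∀ m d x {b} → fromℕ d ≤ m · x → U x b → ι d ℚ.≤ ι m ℚ.* b
  fromℕ≤· m d x {b} d≤mx xb with ι d ℚ.≤? ι m ℚ.* b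
  ... | yes d≤mb = d≤mb
  ... | no  d≰mb =
    let (q , mb<q , q<d) = ℚ.<-dense (ℚ.≰⇒> d≰mb)
    in contradiction (ℚ.≤-<-trans (L-·-≤ m x (d≤mx q q<d) xb) mb<q) (ℚ.<-irrefl refl)

  -- By contraposition: if `ι m * b < ι d`, all lower bounds of `m · x` lie below `ι d`. The order
  -- on rationals is decidable, so a negated hypothesis suffices.
  ·≰fromℕ : ∀ m d x {b} → ¬ (m · x ≤ fromℕ d) → U x b → ι d ℚ.≤ ι m ℚ.* b
  ·≰fromℕ m d x mx≰d xb = ℚ.≮⇒≥ λ mb<d → mx≰d λ q mxq → ℚ.≤-<-trans (L-·-≤ m x mxq xb) mb<d

  -- Bounds on the reciprocal.

  -- Lower bounds of `1/x` are the rationals below `1/u` for some upper bound `u` of `x`, and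
  -- `1 ≤ d u` means `1/u ≤ d`.
  recip-≤ : ∀ x d (pos : 0ℝ < x) → (∀ {u} → U x u → 1ℚ ℚ.≤ ι d ℚ.* u) → recip x pos ≤ fromℕ d
  recip-≤ x d (a , 0<a , xa) 1≤du q (u , r , xu , ur≡1 , q<r) =
    ℚ.<-≤-trans q<r (ℚ.*-cancelʳ-≤-pos u {{positive (ℚ.<-trans 0<a (L<U x xa xu))}}
      (subst (ℚ._≤ ι d ℚ.* u) (trans (sym ur≡1) (ℚ.*-comm u r)) (1≤du xu)))

  -- Cancel `n` in `n ≤ 2M(t + D) ≤ 2Mn(b + e) ≤ nMu`, where `b` and `e` stand for upper bounds of
  -- `c` and `ε`.
  reciprocal-bound : ∀ n t D M {e b u} .{{_ : ℕ.NonZero n}} → n ℕ.≤ M ℕ.* (2 ℕ.* (t ℕ.+ D)) →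
                     ι t ℚ.≤ ι n ℚ.* b → ι D ℚ.≤ ι n ℚ.* e → ι 2 ℚ.* (e ℚ.+ b) ℚ.≤ u →
                     1ℚ ℚ.≤ ι M ℚ.* u
  reciprocal-bound n t D M {e} {b} {u} n≤MS t≤nb D≤ne 2[e+b]≤u =
    ℚ.*-cancelˡ-≤-pos (ι n) {{ℚ.normalize-pos n 1}} (begin
      ι n ℚ.* 1ℚ                                     ≡⟨ ℚ.*-identityʳ (ι n) ⟩
      ι n                                            ≤⟨ ι-mono n≤MS ⟩
      ι (M ℕ.* (2 ℕ.* (t ℕ.+ D)))                    ≡⟨ ι-* M (2 ℕ.* (t ℕ.+ D)) ⟩
      ι M ℚ.* ι (2 ℕ.* (t ℕ.+ D))                    ≡⟨ cong (ι M ℚ.*_) (ι-* 2 (t ℕ.+ D)) ⟩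
      ι M ℚ.* (ι 2 ℚ.* ι (t ℕ.+ D))                  ≡⟨ cong (λ s → ι M ℚ.* (ι 2 ℚ.* s)) (ι-+ t D) ⟩
      ι M ℚ.* (ι 2 ℚ.* (ι t ℚ.+ ι D))                ≤⟨ ι*-mono M (ι*-mono 2 (ℚ.+-mono-≤ t≤nb D≤ne)) ⟩
      ι M ℚ.* (ι 2 ℚ.* (ι n ℚ.* b ℚ.+ ι n ℚ.* e))    ≡⟨ factor (ι M) (ι 2) (ι n) b e ⟩
      ι n ℚ.* (ι M ℚ.* (ι 2 ℚ.* (e ℚ.+ b)))          ≤⟨ ι*-mono n (ι*-mono M 2[e+b]≤u) ⟩
      ι n ℚ.* (ι M ℚ.* u)                            ∎)
    where
    open ℚ.≤-Reasoning
    factor : ∀ M k n b e → M ℚ.* (k ℚ.* (n ℚ.* b ℚ.+ n ℚ.* e)) ≡ n ℚ.* (M ℚ.* (k ℚ.* (e ℚ.+ b)))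
    factor = solve 5 (λ M k n b e → M :* (k :* (n :* b :+ n :* e)) := n :* (M :* (k :* (e :+ b)))) refl
      where open ℚ-Solver

-- Choice of the length, and conclusion.

between-multiples : ∀ n s .{{_ : ℕ.NonZero n}} .{{_ : ℕ.NonZero s}} →
                    ∃[ m ] m ℕ.* s ℕ.< n × n ℕ.≤ ℕ.suc m ℕ.* s
-- The predecessor is divided, so that the lower inequality stays strict at exact multiples of `s`.
between-multiples (ℕ.suc n) s = n / s , ℕ.s≤s (m/n*n≤m n s) ,
  ℕ.≤-<-trans (ℕ.≤-reflexive (m≡m%n+[m/n]*n n s)) (ℕ.+-monoˡ-< (n / s ℕ.* s) (m%n<n n s))

module _ {n : ℕ} (G : Graph n) (c : ℝ)
         (no-bipartite : ¬ (Σ[ X ∈ Subset n ] Σ[ Y ∈ Subset n ]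
           (n · c ≤ fromℕ ∣ X ∣ × n · c ≤ fromℕ ∣ Y ∣ × EmptyBipartite G X Y)))
         where

  -- For `t = s + 1` there is an empty bipartite graph with both sides at least `t`; `cn ≤ t` would
  -- make it a forbidden one.
  threshold≤cn : 0ℝ ≤ c → ∀ t → (∀ {s} → t ≡ ℕ.suc s → EmptyBipartiteAbove G s) →
                 ∀ {b} → ℝ.U c b → ι t ℚ.≤ ι n ℚ.* b
  threshold≤cn 0≤c ℕ.zero _ {b} cb =
    subst (ℚ._≤ ι n ℚ.* b) (ℚ.*-zeroʳ (ι n)) (ι*-mono n (0≤⇒U-nonNeg c 0≤c cb))
  threshold≤cn _ (ℕ.suc s) bipartite cb = ·≰fromℕ n (ℕ.suc s) c cn≰t cb
    where
    cn≰t : ¬ (n · c ≤ fromℕ (ℕ.suc s))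
    cn≰t cn≤t =
      let (X , Y , s<X , s<Y , empty) = bipartite refl
      in no-bipartite (X , Y , (λ q h → ℚ.<-≤-trans (cn≤t q h) (ι-mono s<X))
                             , (λ q h → ℚ.<-≤-trans (cn≤t q h) (ι-mono s<Y)) , empty)

theorem3 : (n : ℕ) → 2 ℕ.≤ n →
    (c ε : ℝ) → 0ℝ ≤ c → c ≤ 1ℝ → 0ℝ ≤ ε → ε ≤ 1ℝ →
    (G : Graph n) → Connected G →
    ¬ (Σ[ X ∈ Subset n ] Σ[ Y ∈ Subset n ]
    (n · c ≤ fromℕ ∣ X ∣ × n · c ≤ fromℕ ∣ Y ∣ × EmptyBipartite G X Y)) →
    (∀ x → fromℕ (closedDegree G x) ≤ n · ε) →
    Σ[ pos ∈ 0ℝ < 2 · (ε + c) ]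
    ((x : Fin n) → ∃[ k ] Σ[ P ∈ InducedPath G k ]
    (StartsIn G P x × recip (2 · (ε + c)) pos ≤ fromℕ k))
theorem3 n@(ℕ.suc _) _ c ε 0≤c _ _ _ G connected no-bipartite deg≤εn =
  conclude (maximum (closedDegree G)) (least-threshold G)
  where
  conclude : ∃[ i ] (∀ j → closedDegree G j ℕ.≤ closedDegree G i) →
             ∃[ t ] NoEmptyBipartiteAbove G t × (∀ {s} → t ≡ ℕ.suc s → EmptyBipartiteAbove G s) →
             Σ[ pos ∈ 0ℝ < 2 · (ε + c) ]
             ((x : Fin n) → ∃[ k ] Σ[ P ∈ InducedPath G k ]
             (StartsIn G P x × recip (2 · (ε + c)) pos ≤ fromℕ k))
  conclude (x₀ , deg≤D) (t , free , bipartite) = pos , path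
    where
    D : ℕ
    D = closedDegree G x₀

    pos : 0ℝ < 2 · (ε + c)
    -- Closed degrees are at least 1, so `½ < D ≤ nε` and hence `ε > 0`.
    pos = 0<2· (ε + c) (0<+0≤ ε c (0<·⇒0< n ε (½ , ℚ.positive⁻¹ ½ , deg≤εn x₀ ½ ½<D)) 0≤c)
      where
      ½<D : ½ ℚ.< ι D
      ½<D = ℚ.<-≤-trans (ℚ.*<* (ℤ.+<+ (ℕ.s≤s (ℕ.s≤s ℕ.z≤n)))) (ι-mono {1} {D} (0<closedDegree G x₀))

    path : (x : Fin n) → ∃[ k ] Σ[ P ∈ InducedPath G k ]
           (StartsIn G P x × recip (2 · (ε + c)) pos ≤ fromℕ k)
    -- The path has `m + 1` vertices: `m · 2(t + D) < n` allows building it, and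
    -- `n ≤ (m + 1) · 2(t + D)` makes it long enough.
    path x = finish (between-multiples n (2 ℕ.* (t ℕ.+ D)) {{_}} {{ℕ.>-nonZero 0<2[t+D]}})
      where
      0<2[t+D] : 0 ℕ.< 2 ℕ.* (t ℕ.+ D)
      0<2[t+D] = ℕ.<-≤-trans (0<closedDegree G x₀) (ℕ.≤-trans (ℕ.m≤n+m D t) (ℕ.m≤m+n (t ℕ.+ D) _))

      finish : (∃[ m ] m ℕ.* (2 ℕ.* (t ℕ.+ D)) ℕ.< n × n ℕ.≤ ℕ.suc m ℕ.* (2 ℕ.* (t ℕ.+ D))) →
               ∃[ k ] Σ[ P ∈ InducedPath G k ] (StartsIn G P x × recip (2 · (ε + c)) pos ≤ fromℕ k)
      finish (m , m2[t+D]<n , n≤[1+m]2[t+D]) =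
        let (P , starts , _) = long-path G free deg≤D m (connected⇒connectedSet-⊤ G connected) (∈⊤ {x = x})
                                 (subst (m ℕ.* (2 ℕ.* (t ℕ.+ D)) ℕ.<_) (sym (∣⊤∣≡n n)) m2[t+D]<n)
        in ℕ.suc m , P , starts , recip-≤ (2 · (ε + c)) (ℕ.suc m) pos 1≤[1+m]u
        where
        1≤[1+m]u : ∀ {u} → ℝ.U (2 · (ε + c)) u → 1ℚ ℚ.≤ ι (ℕ.suc m) ℚ.* u
        1≤[1+m]u xu =
          -- An upper bound `u` of `2(ε + c)` is at least `2(e + b)` for suitable upper bounds `e`
          -- of `ε` and `b` of `c`.
          let (a , (e , b , εe , cb , e+b<a) , 2a≤u) = U-·⁻ 2 (ε + c) xu
          in reciprocal-bound n t D (ℕ.suc m) n≤[1+m]2[t+D]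
               (threshold≤cn G c no-bipartite 0≤c t bipartite cb)
               (fromℕ≤· n D ε (deg≤εn x₀) εe)
               (ℚ.≤-trans (ι*-mono 2 (ℚ.<⇒≤ e+b<a)) 2a≤u)
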